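{- Let $\mathcal L$ be a commutative residuated complete lattice. The negation of $USC(\mathcal L)$ is involutive (i.e. $\underline 1\dot-(\underline 1\dot-f)=f$ for all $f\in USC(\mathcal L)$) if and only if the negation of $\mathcal L$ is involutive (i.e. $(u\nrightarrow\bot)\nrightarrow\bot=u$ for all $u\in\mathcal L$).
   Context: A commutative residuated complete lattice is a complete lattice $\mathcal L$ (least $\bot$, greatest $\top$) with a commutative associative operation $\otimes$ with neutral element $\top$ and an operation $\nrightarrow$ with $u\otimes v\le w\iff u\le v\nrightarrow w$. $USC(\mathcal L)$ is the set of maps $f:[0,1]\to\mathcal L$ preserving arbitrary suprema (so $f(0)=\bot$), ordered by $f\le g\iff g(q)\le f(q)$ for all $q\in[0,1]$. Its greatest element is $\underline 1:q\mapsto\bot$. For $f,g\in USC(\mathcal L)$, $(f\dot+g)(q)=\bigvee\{f(p)\otimes g(r):p,r\in[0,1],\ p+r<q\}$, and $\dot-$ is its residual: $f\dot-g$ is the least $h$ with $f\le g\dot+h$; explicitly $(f\dot-g)(q)=\bigvee_{p<q}\bigwedge_{r\ge p}\big(g(r-p)\nrightarrow f(r)\big)$. -}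

module Defs where

open import Algebra.Structures using (IsCommutativeMonoid)
open import Axiom.ExcludedMiddle using (ExcludedMiddle)
open import Data.Bool.Base using (Bool; true; false)
import Data.Empty as Empty
open import Data.Product.Base using (Σ; ∃; ∃₂; _×_; _,_; proj₁; proj₂)
open import Data.Rational.Base as ℚ using (ℚ; 0ℚ; 1ℚ; ½)
import Data.Rational.Properties as ℚ
open import Data.Rational.Solver using (module +-*-Solver)
open import Data.Sum.Base using (_⊎_; inj₁; inj₂; [_,_]′)
open import Function.Base using (_∘_)
open import Function.Bundles using (_⇔_; mk⇔)
open import Level using (Level; Lift; lift; suc; _⊔_)
open import Relation.Binary.Bundles using (Poset)
open import Relation.Binary.Core using (Rel)
open import Relation.Binary.Definitions using (Minimum; Maximum)
open import Relation.Binary.Lattice.Definitions using (Exponential)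
open import Relation.Binary.PropositionalEquality using (_≡_; refl; subst)
open import Relation.Nullary.Decidable.Core using (yes; no)
open import Relation.Nullary.Negation.Core using (¬_; contradiction)

record CompleteLattice c ℓ₁ ℓ₂ ι : Set (suc (c ⊔ ℓ₁ ⊔ ℓ₂ ⊔ ι)) where
  field
    poset : Poset c ℓ₁ ℓ₂

  open Poset poset public
    renaming (refl to ≤-refl; trans to ≤-trans; reflexive to ≤-reflexive; antisym to ≤-antisym)

  field
    ⋁ ⋀        : {I : Set ι} → (I → Carrier) → Carrier
    ⋁-upper    : {I : Set ι} (x : I → Carrier) → ∀ i → x i ≤ ⋁ x
    ⋁-least    : {I : Set ι} (x : I → Carrier) → ∀ u → (∀ i → x i ≤ u) → ⋁ x ≤ u
    ⋀-lower    : {I : Set ι} (x : I → Carrier) → ∀ i → ⋀ x ≤ x i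
    ⋀-greatest : {I : Set ι} (x : I → Carrier) → ∀ u → (∀ i → u ≤ x i) → u ≤ ⋀ x

  ⊥ ⊤ : Carrier
  ⊥ = ⋁ {Lift ι Empty.⊥} λ ()
  ⊤ = ⋀ {Lift ι Empty.⊥} λ ()

  minimum : Minimum _≤_ ⊥
  minimum u = ⋁-least _ u λ ()

  maximum : Maximum _≤_ ⊤
  maximum u = ⋀-greatest _ u λ ()

record CommutativeResiduatedCompleteLattice c ℓ₁ ℓ₂ ι : Set (suc (c ⊔ ℓ₁ ⊔ ℓ₂ ⊔ ι)) where
  infixr 7 _⊗_
  infixr 6 _↛_

  field
    completeLattice : CompleteLattice c ℓ₁ ℓ₂ ι

  open CompleteLattice completeLattice public

  field
    _⊗_                   : Carrier → Carrier → Carrier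
    ⊗-isCommutativeMonoid : IsCommutativeMonoid _≈_ _⊗_ ⊤
    _↛_                   : Carrier → Carrier → Carrier
    residuated            : Exponential _≤_ _⊗_ _↛_

  ⊗-comm-≤ : ∀ u v → (u ⊗ v) ≤ (v ⊗ u)
  ⊗-comm-≤ u v = ≤-reflexive (IsCommutativeMonoid.comm ⊗-isCommutativeMonoid u v)

  curry : ∀ {u v w} → (u ⊗ v) ≤ w → u ≤ (v ↛ w)
  curry = proj₁ (residuated _ _ _)

  uncurry : ∀ {u v w} → u ≤ (v ↛ w) → (u ⊗ v) ≤ w
  uncurry = proj₂ (residuated _ _ _)

  ⊗-monoˡ : ∀ {u u′ v} → u ≤ u′ → (u ⊗ v) ≤ (u′ ⊗ v)
  ⊗-monoˡ u≤u′ = uncurry (≤-trans u≤u′ (curry ≤-refl))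

  ⊗-monoʳ : ∀ {u v v′} → v ≤ v′ → (u ⊗ v) ≤ (u ⊗ v′)
  ⊗-monoʳ v≤v′ = ≤-trans (⊗-comm-≤ _ _) (≤-trans (⊗-monoˡ v≤v′) (⊗-comm-≤ _ _))

  ↛-mono : ∀ {u u′ v v′} → u′ ≤ u → v ≤ v′ → (u ↛ v) ≤ (u′ ↛ v′)
  ↛-mono u′≤u v≤v′ = curry (≤-trans (⊗-monoʳ u′≤u) (≤-trans (uncurry ≤-refl) v≤v′))

private
  open +-*-Solver using (solve; _:=_; _:+_; _:*_; :-_; con)

  shift-≤ : ∀ {a b c d} → a ℚ.≤ b → a ℚ.+ d ≡ b ℚ.+ c → c ℚ.≤ d
  shift-≤ a≤b eq = ℚ.≮⇒≥ λ d<c → ℚ.<-irrefl eq (ℚ.+-mono-≤-< a≤b d<c)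

  shift-< : ∀ {a b c d} → a ℚ.< b → a ℚ.+ d ≡ b ℚ.+ c → c ℚ.< d
  shift-< a<b eq = ℚ.≰⇒> λ d≤c → ℚ.<-irrefl eq (ℚ.+-mono-<-≤ a<b d≤c)

record ℚ⁺ : Set where
  constructor _,⁺_
  field
    value    : ℚ
    positive : 0ℚ ℚ.< value

open ℚ⁺ using () renaming (value to ⟨_⟩; positive to 0<⟨_⟩)

half : ℚ⁺ → ℚ⁺
half (ε ,⁺ 0<ε) = (½ ℚ.* ε) ,⁺ ℚ.positive⁻¹ (½ ℚ.* ε)
  where instance
    _ = ℚ.positive 0<ε
    _ = ℚ.pos*pos⇒pos ½ ε

-- Cauchy reals as regular functions: approx ε is a rational approximation
-- with error at most ε. Swapping ε and δ in `regular` gives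
-- ∣ approx ε - approx δ ∣ ≤ ε + δ.
record ℝ : Set where
  field
    approx  : ℚ⁺ → ℚ
    regular : ∀ ε δ → approx ε ℚ.≤ approx δ ℚ.+ (⟨ ε ⟩ ℚ.+ ⟨ δ ⟩)

open ℝ

module Real where

  infix  4 _<_ _≤_
  infixl 6 _+_ _-_
  infix  8 -_

  _<_ : Rel ℝ _
  x < y = ∃ λ ε → approx x ε ℚ.+ (⟨ ε ⟩ ℚ.+ ⟨ ε ⟩) ℚ.< approx y ε

  _≤_ : Rel ℝ _
  x ≤ y = ¬ (y < x)

  fromℚ : ℚ → ℝ
  fromℚ a = record
    { approx  = λ _ → a
    ; regular = λ ε δ → shift-≤ (ℚ.+-mono-≤ (ℚ.<⇒≤ 0<⟨ ε ⟩) (ℚ.<⇒≤ 0<⟨ δ ⟩))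
        (solve 3 (λ a e d → (con 0ℚ :+ con 0ℚ) :+ (a :+ (e :+ d)) := (e :+ d) :+ a) refl a ⟨ ε ⟩ ⟨ δ ⟩)
    }

  0ℝ 1ℝ : ℝ
  0ℝ = fromℚ 0ℚ
  1ℝ = fromℚ 1ℚ

  _+_ : ℝ → ℝ → ℝ
  x + y = record
    { approx  = λ ε → approx x (half ε) ℚ.+ approx y (half ε)
    ; regular = λ ε δ → shift-≤ (ℚ.+-mono-≤ (regular x (half ε) (half δ)) (regular y (half ε) (half δ)))
        (solve 6 (λ x y x′ y′ e d →
            (x :+ y) :+ ((x′ :+ y′) :+ (e :+ d)) :=
            ((x′ :+ (con ½ :* e :+ con ½ :* d)) :+ (y′ :+ (con ½ :* e :+ con ½ :* d))) :+ (x :+ y))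
          refl (approx x (half ε)) (approx y (half ε)) (approx x (half δ)) (approx y (half δ)) ⟨ ε ⟩ ⟨ δ ⟩)
    }

  -_ : ℝ → ℝ
  - x = record
    { approx  = λ ε → ℚ.- approx x ε
    ; regular = λ ε δ → shift-≤ (regular x δ ε)
        (solve 4 (λ x x′ e d → x′ :+ (:- x′ :+ (e :+ d)) := (x :+ (d :+ e)) :+ :- x)
          refl (approx x ε) (approx x δ) ⟨ ε ⟩ ⟨ δ ⟩)
    }

  _-_ : ℝ → ℝ → ℝ
  x - y = x + - y

  Gap : Rel ℝ _
  Gap x y = ∃ λ d → ∀ ε → approx x ε ℚ.+ ⟨ d ⟩ ℚ.≤ approx y ε ℚ.+ (⟨ ε ⟩ ℚ.+ ⟨ ε ⟩)

  <⇒Gap : ∀ {x y} → x < y → Gap x y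
  <⇒Gap {x} {y} (e , lt) =
    ((approx y e ℚ.- (approx x e ℚ.+ (⟨ e ⟩ ℚ.+ ⟨ e ⟩))) ,⁺
      shift-< lt (solve 2 (λ a b → a :+ (b :+ :- a) := b :+ con 0ℚ) refl
        (approx x e ℚ.+ (⟨ e ⟩ ℚ.+ ⟨ e ⟩)) (approx y e))) ,
    λ ε → shift-≤ (ℚ.+-mono-≤ (regular x ε e) (regular y e ε))
      (solve 6 (λ x y x′ y′ e d →
          (x :+ y′) :+ (y :+ (d :+ d)) :=
          ((x′ :+ (d :+ e)) :+ (y :+ (e :+ d))) :+ (x :+ (y′ :+ :- (x′ :+ (e :+ e)))))
        refl (approx x ε) (approx y ε) (approx x e) (approx y e) ⟨ e ⟩ ⟨ ε ⟩)

  gap-at : ∀ {x y} → Gap x y →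
    ∃ λ ε → approx x ε ℚ.+ (⟨ ε ⟩ ℚ.+ ⟨ ε ⟩ ℚ.+ ⟨ ε ⟩ ℚ.+ ⟨ ε ⟩ ℚ.+ ⟨ ε ⟩ ℚ.+ ⟨ ε ⟩) ℚ.≤ approx y ε
  gap-at {x} {y} (d , h) = ε , shift-≤ (h ε)
      (solve 3 (λ x y d → let e = con ½ :* (con ½ :* (con ½ :* d)) in
          (x :+ d) :+ y := (y :+ (e :+ e)) :+ (x :+ (e :+ e :+ e :+ e :+ e :+ e)))
        refl (approx x ε) (approx y ε) ⟨ d ⟩)
    where ε = half (half (half d))

  Gap⇒< : ∀ {x y} → Gap x y → x < y
  Gap⇒< {x} {y} g = let ε , h = gap-at {x} {y} g in
      ε , ℚ.<-≤-trans (ℚ.+-monoʳ-< (approx x ε) (2ε<6ε ε)) h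
    where
    step : ∀ ε a → a ℚ.< a ℚ.+ ⟨ ε ⟩
    step ε a = shift-< 0<⟨ ε ⟩ (solve 2 (λ a e → con 0ℚ :+ (a :+ e) := e :+ a) refl a ⟨ ε ⟩)

    2ε<6ε : ∀ ε → ⟨ ε ⟩ ℚ.+ ⟨ ε ⟩ ℚ.< ⟨ ε ⟩ ℚ.+ ⟨ ε ⟩ ℚ.+ ⟨ ε ⟩ ℚ.+ ⟨ ε ⟩ ℚ.+ ⟨ ε ⟩ ℚ.+ ⟨ ε ⟩
    2ε<6ε ε = ℚ.<-trans (step ε _) (ℚ.<-trans (step ε _) (ℚ.<-trans (step ε _) (step ε _)))

  <-irrefl : ∀ {x} → ¬ (x < x)
  <-irrefl {x} (ε , lt) = ℚ.<-asym 0<⟨ ε ⟩ (ε<0)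
    where
    ε+ε<0 : ⟨ ε ⟩ ℚ.+ ⟨ ε ⟩ ℚ.< 0ℚ
    ε+ε<0 = shift-< lt (solve 2 (λ x e → (x :+ (e :+ e)) :+ con 0ℚ := x :+ (e :+ e)) refl (approx x ε) ⟨ ε ⟩)
    ε<0 : ⟨ ε ⟩ ℚ.< 0ℚ
    ε<0 = ℚ.<-trans (shift-< 0<⟨ ε ⟩ (solve 1 (λ e → con 0ℚ :+ (e :+ e) := e :+ e) refl ⟨ ε ⟩)) ε+ε<0

  <-asym : ∀ {x y} → x < y → ¬ (y < x)
  <-asym {x} {y} x<y (ε , lt) = let d , h = <⇒Gap {x} {y} x<y in
    ℚ.<-irrefl refl (ℚ.<-trans 0<⟨ d ⟩
    (shift-< (ℚ.+-mono-≤-< (h ε) lt)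
      (solve 4 (λ x y d e →
          ((x :+ d) :+ (y :+ (e :+ e))) :+ con 0ℚ := ((y :+ (e :+ e)) :+ x) :+ d)
        refl (approx x ε) (approx y ε) ⟨ d ⟩ ⟨ ε ⟩)))

  <-cotrans : ∀ {x y} → x < y → ∀ z → x < z ⊎ z < y
  <-cotrans {x} {y} x<y z = let ε , h = gap-at {x} {y} (<⇒Gap {x} {y} x<y) in compare ε h
    where
    compare : ∀ ε →
      approx x ε ℚ.+ (⟨ ε ⟩ ℚ.+ ⟨ ε ⟩ ℚ.+ ⟨ ε ⟩ ℚ.+ ⟨ ε ⟩ ℚ.+ ⟨ ε ⟩ ℚ.+ ⟨ ε ⟩) ℚ.≤ approx y ε →
      x < z ⊎ z < y
    compare ε h with (approx x ε ℚ.+ (⟨ ε ⟩ ℚ.+ ⟨ ε ⟩)) ℚ.<? approx z ε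
    ... | yes x<z = inj₁ (ε , x<z)
    ... | no  x≮z = inj₂ (ε , shift-< (ℚ.+-mono-≤-< (ℚ.+-mono-≤ h (ℚ.≮⇒≥ x≮z)) (ℚ.+-mono-< 0<⟨ ε ⟩ 0<⟨ ε ⟩))
      (solve 4 (λ x y z e →
          (((x :+ (e :+ e :+ e :+ e :+ e :+ e)) :+ z) :+ (con 0ℚ :+ con 0ℚ)) :+ y :=
          ((y :+ (x :+ (e :+ e))) :+ (e :+ e)) :+ (z :+ (e :+ e)))
        refl (approx x ε) (approx y ε) (approx z ε) ⟨ ε ⟩))

  <-≤-trans : ∀ {x y z} → x < y → y ≤ z → x < z
  <-≤-trans {x} {y} {z} x<y y≤z =
    [ (λ x<z → x<z) , (λ z<y → contradiction z<y y≤z) ]′ (<-cotrans {x} {y} x<y z)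

  ≤-<-trans : ∀ {x y z} → x ≤ y → y < z → x < z
  ≤-<-trans {x} {y} {z} x≤y y<z =
    [ (λ y<x → contradiction y<x x≤y) , (λ x<z → x<z) ]′ (<-cotrans {y} {z} y<z x)

  <⇒≤ : ∀ {x y} → x < y → x ≤ y
  <⇒≤ {x} {y} = <-asym {x} {y}

  ≤-refl : ∀ {x} → x ≤ x
  ≤-refl {x} = <-irrefl {x}

  ≤-trans : ∀ {x y z} → x ≤ y → y ≤ z → x ≤ z
  ≤-trans {x} {y} {z} x≤y y≤z z<x = x≤y (≤-<-trans {y} {z} {x} y≤z z<x)

  ≤-intro : ∀ {x y} → (∀ ε → approx x ε ℚ.≤ approx y ε ℚ.+ (⟨ ε ⟩ ℚ.+ ⟨ ε ⟩)) → x ≤ y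
  ≤-intro h (ε , lt) = ℚ.<-irrefl refl (ℚ.<-≤-trans lt (h ε))

  <-dense : ∀ {x y} → x < y → ∃ λ z → x < z × z < y
  <-dense {x} {y} x<y = let ε , h = gap-at {x} {y} (<⇒Gap {x} {y} x<y) in
    fromℚ (approx x ε ℚ.+ (⟨ ε ⟩ ℚ.+ ⟨ ε ⟩ ℚ.+ ⟨ ε ⟩)) ,
    (ε , shift-< 0<⟨ ε ⟩
      (solve 2 (λ x e → con 0ℚ :+ (x :+ (e :+ e :+ e)) := e :+ (x :+ (e :+ e))) refl (approx x ε) ⟨ ε ⟩)) ,
    (ε , shift-< (ℚ.+-mono-≤-< h 0<⟨ ε ⟩)
      (solve 3 (λ x y e →
          ((x :+ (e :+ e :+ e :+ e :+ e :+ e)) :+ con 0ℚ) :+ y :=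
          (y :+ e) :+ ((x :+ (e :+ e :+ e)) :+ (e :+ e)))
        refl (approx x ε) (approx y ε) ⟨ ε ⟩))

  +-comm-≤ : ∀ x y → x + y ≤ y + x
  +-comm-≤ x y = ≤-intro {x + y} {y + x} λ ε →
    shift-≤ (ℚ.+-mono-≤ (ℚ.<⇒≤ 0<⟨ ε ⟩) (ℚ.<⇒≤ 0<⟨ ε ⟩))
      (solve 3 (λ x y e → (con 0ℚ :+ con 0ℚ) :+ ((y :+ x) :+ (e :+ e)) := (e :+ e) :+ (x :+ y))
        refl (approx x (half ε)) (approx y (half ε)) ⟨ ε ⟩)

  x+y-y≤x : ∀ x y → x + y - y ≤ x
  x+y-y≤x x y = ≤-intro {x + y - y} {x} λ ε →
    shift-≤ (ℚ.+-mono-≤ (regular x (half (half ε)) ε) (regular y (half (half ε)) (half ε)))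
      (solve 5 (λ x x′ y y′ e →
          (x′ :+ y) :+ (x :+ (e :+ e)) :=
          ((x :+ (con ½ :* (con ½ :* e) :+ e)) :+ (y′ :+ (con ½ :* (con ½ :* e) :+ con ½ :* e)))
            :+ ((x′ :+ y) :+ :- y′))
        refl (approx x ε) (approx x (half (half ε))) (approx y (half (half ε))) (approx y (half ε)) ⟨ ε ⟩)

  x≤x+y-y : ∀ x y → x ≤ x + y - y
  x≤x+y-y x y = ≤-intro {x} {x + y - y} λ ε →
    shift-≤ (ℚ.+-mono-≤ (regular x ε (half (half ε))) (regular y (half ε) (half (half ε))))
      (solve 5 (λ x x′ y y′ e →
          (x :+ y′) :+ (((x′ :+ y) :+ :- y′) :+ (e :+ e)) :=
          ((x′ :+ (e :+ con ½ :* (con ½ :* e))) :+ (y :+ (con ½ :* e :+ con ½ :* (con ½ :* e))))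
            :+ x)
        refl (approx x ε) (approx x (half (half ε))) (approx y (half (half ε))) (approx y (half ε)) ⟨ ε ⟩)

  x-y+y≤x : ∀ x y → x - y + y ≤ x
  x-y+y≤x x y = ≤-intro {x - y + y} {x} λ ε →
    shift-≤ (ℚ.+-mono-≤ (regular x (half (half ε)) ε) (regular y (half ε) (half (half ε))))
      (solve 5 (λ x x′ y y′ e →
          (x′ :+ y′) :+ (x :+ (e :+ e)) :=
          ((x :+ (con ½ :* (con ½ :* e) :+ e)) :+ (y :+ (con ½ :* e :+ con ½ :* (con ½ :* e))))
            :+ ((x′ :+ :- y) :+ y′))
        refl (approx x ε) (approx x (half (half ε))) (approx y (half (half ε))) (approx y (half ε)) ⟨ ε ⟩)

  x≤x-y+y : ∀ x y → x ≤ x - y + y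
  x≤x-y+y x y = ≤-intro {x} {x - y + y} λ ε →
    shift-≤ (ℚ.+-mono-≤ (regular x ε (half (half ε))) (regular y (half (half ε)) (half ε)))
      (solve 5 (λ x x′ y y′ e →
          (x :+ y) :+ (((x′ :+ :- y) :+ y′) :+ (e :+ e)) :=
          ((x′ :+ (e :+ con ½ :* (con ½ :* e))) :+ (y′ :+ (con ½ :* (con ½ :* e) :+ con ½ :* e)))
            :+ x)
        refl (approx x ε) (approx x (half (half ε))) (approx y (half (half ε))) (approx y (half ε)) ⟨ ε ⟩)

  0+x≤x : ∀ x → 0ℝ + x ≤ x
  0+x≤x x = ≤-intro {0ℝ + x} {x} λ ε →
    shift-≤ (ℚ.+-mono-≤ (regular x (half ε) ε) (ℚ.<⇒≤ 0<⟨ half ε ⟩))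
      (solve 3 (λ x x′ e →
          (x′ :+ con 0ℚ) :+ (x :+ (e :+ e)) :=
          ((x :+ (con ½ :* e :+ e)) :+ con ½ :* e) :+ (con 0ℚ :+ x′))
        refl (approx x ε) (approx x (half ε)) ⟨ ε ⟩)

  x≤0+x : ∀ x → x ≤ 0ℝ + x
  x≤0+x x = ≤-intro {x} {0ℝ + x} λ ε →
    shift-≤ (ℚ.+-mono-≤ (regular x ε (half ε)) (ℚ.<⇒≤ 0<⟨ half ε ⟩))
      (solve 3 (λ x x′ e →
          (x :+ con 0ℚ) :+ ((con 0ℚ :+ x′) :+ (e :+ e)) :=
          ((x′ :+ (e :+ con ½ :* e)) :+ con ½ :* e) :+ x)
        refl (approx x ε) (approx x (half ε)) ⟨ ε ⟩)

  +-monoˡ-< : ∀ z {x y} → x < y → x + z < y + z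
  +-monoˡ-< z {x} {y} x<y = let d , h = <⇒Gap {x} {y} x<y in
    Gap⇒< {x + z} {y + z} (d , λ ε →
    shift-≤ (ℚ.+-mono-≤ (h (half ε)) (ℚ.<⇒≤ 0<⟨ ε ⟩))
      (solve 5 (λ x y z d e →
          ((x :+ d) :+ con 0ℚ) :+ ((y :+ z) :+ (e :+ e)) :=
          ((y :+ (con ½ :* e :+ con ½ :* e)) :+ e) :+ ((x :+ z) :+ d))
        refl (approx x (half ε)) (approx y (half ε)) (approx z (half ε)) ⟨ d ⟩ ⟨ ε ⟩))

  +-monoˡ-≤ : ∀ z {x y} → x ≤ y → x + z ≤ y + z
  +-monoˡ-≤ z {x} {y} x≤y y+z<x+z = x≤y
    (≤-<-trans {y} {y + z - z} {x} (x≤x+y-y y z)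
      (<-≤-trans {y + z - z} {x + z - z} {x} (+-monoˡ-< (- z) {y + z} {x + z} y+z<x+z) (x+y-y≤x x z)))

  +-monoʳ-< : ∀ z {x y} → x < y → z + x < z + y
  +-monoʳ-< z {x} {y} x<y =
    ≤-<-trans {z + x} {x + z} {z + y} (+-comm-≤ z x)
      (<-≤-trans {x + z} {y + z} {z + y} (+-monoˡ-< z {x} {y} x<y) (+-comm-≤ y z))

  +-monoʳ-≤ : ∀ z {x y} → x ≤ y → z + x ≤ z + y
  +-monoʳ-≤ z {x} {y} x≤y =
    ≤-trans {z + x} {x + z} {z + y} (+-comm-≤ z x)
      (≤-trans {x + z} {y + z} {z + y} (+-monoˡ-≤ z {x} {y} x≤y) (+-comm-≤ y z))

  x+z≤y⇒x≤y-z : ∀ {x y} z → x + z ≤ y → x ≤ y - z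
  x+z≤y⇒x≤y-z {x} {y} z h =
    ≤-trans {x} {x + z - z} {y - z} (x≤x+y-y x z) (+-monoˡ-≤ (- z) {x + z} {y} h)

  x≤y+z⇒x-z≤y : ∀ {x y} z → x ≤ y + z → x - z ≤ y
  x≤y+z⇒x-z≤y {x} {y} z h =
    ≤-trans {x - z} {y + z - z} {y} (+-monoˡ-≤ (- z) {x} {y + z} h) (x+y-y≤x y z)

record 𝕀 : Set where
  field
    value   : ℝ
    0≤value : Real.0ℝ Real.≤ value
    value≤1 : value Real.≤ Real.1ℝ

module UnitInterval where

  open Real hiding (_<_; _≤_; _+_; _-_; <-≤-trans; ≤-<-trans; <⇒≤; ≤-refl; ≤-trans; <-dense)
  open 𝕀

  infix 4 _<_ _≤_ _+_<_

  _<_ _≤_ : Rel 𝕀 _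
  p < q = value p Real.< value q
  p ≤ q = value p Real.≤ value q

  -- The sum is taken in ℝ, since it may exceed 1.
  _+_<_ : 𝕀 → 𝕀 → 𝕀 → Set
  p + r < q = (value p Real.+ value r) Real.< value q

  <-≤-trans : ∀ {p q r} → p < q → q ≤ r → p < r
  <-≤-trans {p} {q} {r} = Real.<-≤-trans {value p} {value q} {value r}

  ≤-<-trans : ∀ {p q r} → p ≤ q → q < r → p < r
  ≤-<-trans {p} {q} {r} = Real.≤-<-trans {value p} {value q} {value r}

  <⇒≤ : ∀ {p q} → p < q → p ≤ q
  <⇒≤ {p} {q} = Real.<⇒≤ {value p} {value q}

  ≤-refl : ∀ {p} → p ≤ p
  ≤-refl {p} = Real.≤-refl {value p}

  <-dense : ∀ {p q} → p < q → ∃ λ m → p < m × m < q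
  <-dense {p} {q} p<q = let m , p<m , m<q = Real.<-dense {value p} {value q} p<q in record
    { value   = m
    ; 0≤value = Real.<⇒≤ {0ℝ} {m} (Real.≤-<-trans {0ℝ} {value p} {m} (0≤value p) p<m)
    ; value≤1 = Real.<⇒≤ {m} {1ℝ} (Real.<-≤-trans {m} {value q} {1ℝ} m<q (value≤1 q))
    } , p<m , m<q

  0𝕀 1𝕀 : 𝕀
  0𝕀 = record
    { value = 0ℝ ; 0≤value = Real.≤-refl {0ℝ}
    ; value≤1 = ≤-intro {0ℝ} {1ℝ} λ ε → ℚ.≤-trans (ℚ.<⇒≤ (ℚ.positive⁻¹ 1ℚ)) (regular 1ℝ ε ε) }
  1𝕀 = record
    { value = 1ℝ ; value≤1 = Real.≤-refl {1ℝ}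
    ; 0≤value = value≤1 0𝕀 }

  difference : ∀ r p → p ≤ r → 𝕀
  difference r p p≤r = record
    { value   = value r Real.- value p
    ; 0≤value = x+z≤y⇒x≤y-z {0ℝ} {value r} (value p)
        (Real.≤-trans {0ℝ Real.+ value p} {value p} {value r} (0+x≤x (value p)) p≤r)
    ; value≤1 = x≤y+z⇒x-z≤y {value r} {1ℝ} (value p)
        (Real.≤-trans {value r} {1ℝ} {1ℝ Real.+ value p} (value≤1 r)
          (Real.≤-trans {1ℝ} {0ℝ Real.+ 1ℝ} {1ℝ Real.+ value p} (x≤0+x 1ℝ)
            (Real.≤-trans {0ℝ Real.+ 1ℝ} {1ℝ Real.+ 0ℝ} {1ℝ Real.+ value p}
              (+-comm-≤ 0ℝ 1ℝ) (+-monoʳ-≤ 1ℝ {0ℝ} {value p} (0≤value p)))))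
    }

  syntax difference r p p≤r = r - p [ p≤r ]

  private
    x≤y+x : ∀ x (p : 𝕀) → x Real.≤ value p Real.+ x
    x≤y+x x p = Real.≤-trans {x} {0ℝ Real.+ x} {value p Real.+ x} (x≤0+x x)
      (+-monoˡ-≤ x {0ℝ} {value p} (0≤value p))

  sum : ∀ p r {q} → p + r < q → 𝕀
  sum p r {q} p+r<q = record
    { value   = value p Real.+ value r
    ; 0≤value = Real.≤-trans {0ℝ} {value r} {value p Real.+ value r} (0≤value r) (x≤y+x (value r) p)
    ; value≤1 = Real.<⇒≤ {value p Real.+ value r} {1ℝ}
        (Real.<-≤-trans {value p Real.+ value r} {value q} {1ℝ} p+r<q (value≤1 q))
    }

  r≤sum : ∀ p r {q} (p+r<q : p + r < q) → r ≤ sum p r {q} p+r<q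
  r≤sum p r _ = x≤y+x (value r) p

  +-monoʳ-<-< : ∀ a {p b c} → p < b → a + b < c → a + p < c
  +-monoʳ-<-< a {p} {b} {c} p<b a+b<c = Real.≤-<-trans {value a Real.+ value p} {value a Real.+ value b} {value c}
    (Real.<⇒≤ {value a Real.+ value p} {value a Real.+ value b} (+-monoʳ-< (value a) {value p} {value b} p<b)) a+b<c

  difference-< : ∀ {r p p′} (p≤r : p ≤ r) → p′ < p → (r - p [ p≤r ]) + p′ < r
  difference-< {r} {p} {p′} _ p′<p =
    Real.<-≤-trans {d Real.+ value p′} {d Real.+ value p} {value r}
      (+-monoʳ-< d {value p′} {value p} p′<p) (x-y+y≤x (value r) (value p))
    where d = value r Real.- value p

  p≤sum-difference : ∀ a p {c} (a+p<c : a + p < c) →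
    a ≤ (sum a p {c} a+p<c - p [ r≤sum a p {c} a+p<c ])
  p≤sum-difference a p _ = x≤x+y-y (value a) (value p)

  -- Suprema in [0,1] are taken in the usual constructive sense. Classically
  -- these are exactly the least upper bounds: see IsSup⇒least and least⇒IsSup.
  record IsSup {ι} {I : Set ι} (x : I → 𝕀) (s : 𝕀) : Set ι where
    field
      upper       : ∀ i → x i ≤ s
      approximate : ∀ {p} → p < s → ∃ λ i → p < x i

  IsSup⇒least : ∀ {ι} {I : Set ι} {x : I → 𝕀} {s} → IsSup x s → ∀ u → (∀ i → x i ≤ u) → s ≤ u
  IsSup⇒least sup u x≤u u<s = let i , u<xᵢ = IsSup.approximate sup {u} u<s in x≤u i u<xᵢ

  least⇒IsSup : ∀ {ι} → ExcludedMiddle ι → {I : Set ι} {x : I → 𝕀} {s : 𝕀} →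
    (∀ i → x i ≤ s) → (∀ u → (∀ i → x i ≤ u) → s ≤ u) → IsSup x s
  least⇒IsSup em {x = x} {s} upper least = record { upper = upper ; approximate = λ {p} → approximate {p} }
    where
    approximate : ∀ {p} → p < s → ∃ λ i → p < x i
    approximate {p} p<s with em {P = ∃ λ i → p < x i}
    ... | yes found = found
    ... | no  none  = contradiction p<s (least p λ i p<xᵢ → none (i , p<xᵢ))

  below-sup : ∀ ι q → IsSup {I = Lift ι (∃ λ p → p < q)} (λ (lift (p , _)) → p) q
  below-sup ι q = record
    { upper       = λ (lift (p , p<q)) → <⇒≤ {p} {q} p<q
    ; approximate = λ {p} p<q → let m , p<m , m<q = <-dense {p} {q} p<q in lift (m , m<q) , p<m
    }

  pair-sup : ∀ ι {p q} → p ≤ q → IsSup {I = Lift ι Bool} (λ { (lift true) → p ; (lift false) → q }) q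
  pair-sup ι {p} {q} p≤q = record
    { upper       = λ { (lift true) → p≤q ; (lift false) → ≤-refl {q} }
    ; approximate = λ r<q → lift false , r<q
    }

module UpperSemicontinuous {c ℓ₁ ℓ₂ ι} (L : CommutativeResiduatedCompleteLattice c ℓ₁ ℓ₂ ι) where

  open CommutativeResiduatedCompleteLattice L
  open UnitInterval using (_+_<_; difference; IsSup)
    renaming (_<_ to _<ᴵ_; _≤_ to _≤ᴵ_)
  private module U = UnitInterval

  infix  4 _⊑_ _≋_
  infixl 6 _∔_ _∸_

  record USC : Set (c ⊔ ℓ₁ ⊔ suc ι) where
    field
      fun       : 𝕀 → Carrier
      preserves : {I : Set ι} (x : I → 𝕀) {s : 𝕀} → IsSup x s → fun s ≈ ⋁ (fun ∘ x)

    mono : ∀ {p q} → p ≤ᴵ q → fun p ≤ fun q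
    mono {p} {q} p≤q = ≤-trans (⋁-upper _ (lift true))
      (≤-reflexive (Eq.sym (preserves _ (U.pair-sup ι {p} {q} p≤q))))

    ≤-below : ∀ q {u} → (∀ {p} → p <ᴵ q → fun p ≤ u) → fun q ≤ u
    ≤-below q {u} h = ≤-trans (≤-reflexive (preserves _ (U.below-sup ι q)))
      (⋁-least _ u λ (lift (p , p<q)) → h {p} p<q)

  open USC

  _⊑_ _≋_ : Rel USC _
  f ⊑ g = ∀ q → fun g q ≤ fun f q
  f ≋ g = ∀ q → fun f q ≈ fun g q

  𝟏 : USC
  𝟏 = record
    { fun       = λ _ → ⊥
    ; preserves = λ x _ → ≤-antisym (minimum _) (⋁-least _ ⊥ λ _ → ≤-refl)
    }

  𝟏-greatest : Maximum _⊑_ 𝟏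
  𝟏-greatest f q = minimum (fun f q)

  _∔_ : USC → USC → USC
  f ∔ g = record
    { fun       = h
    ; preserves = λ x {s} sup → ≤-antisym
        (⋁-least _ _ λ (lift (p , r , p+r<s)) →
          let i , p+r<xᵢ = IsSup.approximate sup {U.sum p r {s} p+r<s} p+r<s in
          ≤-trans (⋁-upper _ (lift (p , r , p+r<xᵢ))) (⋁-upper (h ∘ x) i))
        (⋁-least _ _ λ i → ⋁-least _ _ λ (lift (p , r , p+r<xᵢ)) →
          ⋁-upper _ (lift (p , r ,
            U.<-≤-trans {U.sum p r {x i} p+r<xᵢ} {x i} {s} p+r<xᵢ (IsSup.upper sup i))))
    }
    where
    h : 𝕀 → Carrier
    h q = ⋁ {Lift ι (∃₂ λ p r → p + r < q)} λ (lift (p , r , _)) → fun f p ⊗ fun g r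

  _∸_ : USC → USC → USC
  f ∸ g = record
    { fun       = h
    ; preserves = λ x {s} sup → ≤-antisym
        (⋁-least _ _ λ (lift (p , p<s)) →
          let i , p<xᵢ = IsSup.approximate sup {p} p<s in
          ≤-trans (⋁-upper _ (lift (p , p<xᵢ))) (⋁-upper (h ∘ x) i))
        (⋁-least _ _ λ i → ⋁-least _ _ λ (lift (p , p<xᵢ)) →
          ⋁-upper _ (lift (p , U.<-≤-trans {p} {x i} {s} p<xᵢ (IsSup.upper sup i))))
    }
    where
    h : 𝕀 → Carrier
    h q = ⋁ {Lift ι (∃ λ p → p <ᴵ q)} λ (lift (p , _)) →
          ⋀ {Lift ι (∃ λ r → p ≤ᴵ r)} λ (lift (r , p≤r)) →
          fun g (r U.- p [ p≤r ]) ↛ fun f r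

  ∸-residual : ∀ f g h → f ⊑ (g ∔ h) ⇔ (f ∸ g) ⊑ h
  ∸-residual f g h = mk⇔
    (λ f⊑g∔h q → ≤-below h q λ {p} p<q →
      ≤-trans
        (⋀-greatest _ _ λ (lift (r , p≤r)) → ≤-below h p λ {p′} p′<p →
          curry (≤-trans (⊗-comm-≤ _ _)
            (≤-trans
              (⋁-upper _ (lift (r U.- p [ p≤r ] , p′ , U.difference-< {r} {p} {p′} p≤r p′<p)))
              (f⊑g∔h r))))
        (⋁-upper _ (lift (p , p<q))))
    (λ f∸g⊑h q → ⋁-least _ _ λ (lift (a , b , a+b<q)) →
      ≤-trans (⊗-comm-≤ _ _) (uncurry (≤-trans (f∸g⊑h b)
        (⋁-least _ _ λ (lift (p , p<b)) →
          let a+p<q = U.+-monoʳ-<-< a {p} {b} {q} p<b a+b<q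
              r     = U.sum a p {q} a+p<q
              p≤r   = U.r≤sum a p {q} a+p<q in
          ≤-trans (⋀-lower _ (lift (r , p≤r)))
            (↛-mono (mono g {a} {r U.- p [ p≤r ]} (U.p≤sum-difference a p {q} a+p<q))
                    (mono f {r} {q} (U.<⇒≤ {r} {q} a+p<q)))))))

{-# OPTIONS --safe #-}

-- Since f is monotone, (𝟏 ∸ f)(q) = ⋁_{p<q} (f(1-p) ↛ ⊥), whence
-- (𝟏 ∸ (𝟏 ∸ f))(q) = ⋁_{p<q} ⋀_{t>p} ((f t ↛ ⊥) ↛ ⊥).  If the negation of L is
-- involutive, density of the order and preservation of suprema collapse this to f q.
-- Conversely, the double negation at 1 of the step function that jumps from ⊥ to u
-- at 0 is (u ↛ ⊥) ↛ ⊥.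
module Submission where

open import Defs
open import Data.Product.Base using (_,_)
open import Data.Rational.Base using (0ℚ; 1ℚ; ½; _*_)
open import Data.Rational.Properties using (_<?_)
open import Function.Base using (_∘_)
open import Function.Bundles using (_⇔_; mk⇔; Equivalence)
open import Level using (Level; Lift; lift)
open import Relation.Nullary.Decidable.Core using (toWitness)

open 𝕀

module _ where
  open Real

  x+z<y⇒x<y-z : ∀ {x y} z → x + z < y → x < y - z
  x+z<y⇒x<y-z {x} {y} z x+z<y = ≤-<-trans {x} {x + z - z} {y - z}
    (x≤x+y-y x z) (+-monoˡ-< (- z) {x + z} {y} x+z<y)

  +-swap-< : ∀ x y {z} → x + y < z → y + x < z
  +-swap-< x y {z} = ≤-<-trans {y + x} {x + y} {z} (+-comm-≤ y x)

open UnitInterval using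
  (_<_; _≤_; <-≤-trans; ≤-<-trans; <⇒≤; <-dense; 0𝕀; 1𝕀; difference; difference-<; IsSup)

complement : 𝕀 → 𝕀
complement p = 1𝕀 - p [ value≤1 p ]

complement-anti-< : ∀ {p q} → p < q → complement q < complement p
complement-anti-< {p} {q} p<q =
  x+z<y⇒x<y-z {value (complement q)} {value 1𝕀} (value p) (difference-< {1𝕀} {q} {p} (value≤1 q) p<q)

complement-positive : ∀ {p q} → p < q → 0𝕀 < complement p
complement-positive {p} {q} p<q = ≤-<-trans {0𝕀} {complement q} {complement p}
  (0≤value (complement q)) (complement-anti-< {p} {q} p<q)

-- Since `r ≤ 1 = (1 - p) + p`, removing `1 - p` leaves at most `p`.
difference-complement-≤ : ∀ r p (p′≤r : complement p ≤ r) → (r - complement p [ p′≤r ]) ≤ p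
difference-complement-≤ r p _ =
  Real.x≤y+z⇒x-z≤y {value r} {value p} c
    (Real.≤-trans {value r} {c Real.+ value p} {value p Real.+ c}
      (Real.≤-trans {value r} {Real.1ℝ} {c Real.+ value p}
        (value≤1 r) (Real.x≤x-y+y Real.1ℝ (value p)))
      (Real.+-comm-≤ c (value p)))
  where c = value (complement p)

module _ {c ℓ₁ ℓ₂ ι : Level} (L : CommutativeResiduatedCompleteLattice c ℓ₁ ℓ₂ ι) where

  open CommutativeResiduatedCompleteLattice L
    renaming (_≤_ to _⊴_)
  open UpperSemicontinuous L
  open USC

  u⊴¬¬u : ∀ u → u ⊴ ((u ↛ ⊥) ↛ ⊥)
  u⊴¬¬u u = curry (≤-trans (⊗-comm-≤ _ _) (uncurry ≤-refl))

  -- Take `r = 1`: there `r - p` is largest, so the negation is smallest.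
  ⋀⊴fun-complement↛ : ∀ f p →
    ⋀ {Lift ι _} (λ (lift (r , p≤r)) → fun f (r - p [ p≤r ]) ↛ ⊥) ⊴ (fun f (complement p) ↛ ⊥)
  ⋀⊴fun-complement↛ f p = ⋀-lower _ (lift (1𝕀 , value≤1 p))

  -- The index `1 - m` serves: each `r - (1 - m)` is at most `m`, and negation is antitone.
  fun↛⊴𝟏∸ : ∀ f {m q} → complement m < q → (fun f m ↛ ⊥) ⊴ fun (𝟏 ∸ f) q
  fun↛⊴𝟏∸ f {m} m′<q = ≤-trans
    (⋀-greatest _ _ λ (lift (r , m′≤r)) →
      ↛-mono (mono f {r - complement m [ m′≤r ]} {m} (difference-complement-≤ r m m′≤r)) ≤-refl)
    (⋁-upper _ (lift (complement m , m′<q)))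

  ∔-comm-⊑ : ∀ f g → (f ∔ g) ⊑ (g ∔ f)
  ∔-comm-⊑ f g q = ⋁-least _ _ λ (lift (p , r , p+r<q)) → ≤-trans (⊗-comm-≤ _ _)
    (⋁-upper _ (lift (r , p , +-swap-< (value p) (value r) {value q} p+r<q)))

  -- Residuation gives `𝟏 ⊑ f ∔ (𝟏 ∸ f)`; commuting the sum and residuating again works for every
  -- `L`.
  𝟏∸𝟏∸f⊑f : ∀ f → (𝟏 ∸ (𝟏 ∸ f)) ⊑ f
  𝟏∸𝟏∸f⊑f f = Equivalence.to (∸-residual 𝟏 (𝟏 ∸ f) f) λ q → ≤-trans
    (∔-comm-⊑ f (𝟏 ∸ f) q)
    (Equivalence.from (∸-residual 𝟏 f (𝟏 ∸ f)) (λ _ → ≤-refl) q)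

  f⊑𝟏∸𝟏∸f : (∀ u → ((u ↛ ⊥) ↛ ⊥) ⊴ u) → ∀ f → f ⊑ (𝟏 ∸ (𝟏 ∸ f))
  f⊑𝟏∸𝟏∸f ¬¬u⊴u f q = ⋁-least _ _ λ (lift (p , p<q)) →
    -- `fun↛⊴𝟏∸` at `1 - p` needs `1 - m < 1 - p` strictly, hence a point `m` strictly above `p`.
    let m , p<m , m<q = <-dense {p} {q} p<q in
    ≤-trans (⋀⊴fun-complement↛ (𝟏 ∸ f) p)
      (≤-trans (↛-mono (fun↛⊴𝟏∸ f {m} {complement p} (complement-anti-< {p} {m} p<m)) ≤-refl)
        (≤-trans (¬¬u⊴u _) (mono f {m} {q} (<⇒≤ {m} {q} m<q))))

  -- The join over proofs of 0 < q is u for q > 0 and ⊥ for q = 0, without deciding which.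
  step : Carrier → USC
  step u = record
    { fun       = h
    ; preserves = λ x {s} sup → ≤-antisym
        (⋁-least _ _ λ (lift 0<s) →
          let i , 0<xᵢ = IsSup.approximate sup {0𝕀} 0<s in
          ≤-trans (⋁-upper _ (lift 0<xᵢ)) (⋁-upper (h ∘ x) i))
        (⋁-least _ _ λ i → ⋁-least _ _ λ (lift 0<xᵢ) →
          ⋁-upper _ (lift (<-≤-trans {0𝕀} {x i} {s} 0<xᵢ (IsSup.upper sup i))))
    }
    where
    h : 𝕀 → Carrier
    h q = ⋁ {Lift ι (0𝕀 < q)} λ _ → u

  u⊴step : ∀ u {q} → 0𝕀 < q → u ⊴ fun (step u) q
  u⊴step u 0<q = ⋁-upper _ (lift 0<q)

  -- Every index satisfies `p < q ≤ 1`, so `1 - p` is positive and `step u` is at least `u` there.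
  𝟏∸step⊴ : ∀ u q → fun (𝟏 ∸ step u) q ⊴ (u ↛ ⊥)
  𝟏∸step⊴ u q = ⋁-least _ _ λ (lift (p , p<q)) → ≤-trans (⋀⊴fun-complement↛ (step u) p)
    (↛-mono (u⊴step u {complement p} (complement-positive {p} {q} p<q)) ≤-refl)

  -- The bound `u ↛ ⊥` on `𝟏 ∸ step u` is uniform in its argument, so it bounds every term of the
  -- meet at index `0`.
  ¬¬u⊴𝟏∸𝟏∸step : ∀ u {q} → 0𝕀 < q → ((u ↛ ⊥) ↛ ⊥) ⊴ fun (𝟏 ∸ (𝟏 ∸ step u)) q
  ¬¬u⊴𝟏∸𝟏∸step u 0<q = ≤-trans
    (⋀-greatest _ _ λ (lift (r , 0≤r)) → ↛-mono (𝟏∸step⊴ u (r - 0𝕀 [ 0≤r ])) ≤-refl)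
    (⋁-upper _ (lift (0𝕀 , 0<q)))

0<1 : 0𝕀 < 1𝕀
-- With `ε = ¼` the required `0 + (ε + ε) < 1` is `½ < 1`, decided by evaluation.
0<1 = (¼ ,⁺ toWitness {a? = 0ℚ <? ¼} _) , toWitness {a? = ½ <? 1ℚ} _
  where ¼ = ½ * ½

theorem6p1p1 : {c ℓ₁ ℓ₂ ι : Level} (L : CommutativeResiduatedCompleteLattice c ℓ₁ ℓ₂ ι) →
    let open CommutativeResiduatedCompleteLattice L
        open UpperSemicontinuous L in
    (∀ (f : USC) → (𝟏 ∸ (𝟏 ∸ f)) ≋ f) ⇔ (∀ (u : Carrier) → ((u ↛ ⊥) ↛ ⊥) ≈ u)
theorem6p1p1 L = mk⇔
  (λ involutive u → ≤-antisym
    (≤-trans (¬¬u⊴𝟏∸𝟏∸step L u {1𝕀} 0<1)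
      -- `step u` at `1` is a join of copies of `u`.
      (≤-trans (≤-reflexive (involutive (step L u) 1𝕀)) (⋁-least _ u λ _ → ≤-refl)))
    (u⊴¬¬u L u))
  (λ involutive f q → ≤-antisym
    (f⊑𝟏∸𝟏∸f L (≤-reflexive ∘ involutive) f q)
    (𝟏∸𝟏∸f⊑f L f q))
  where
  open CommutativeResiduatedCompleteLattice L using (≤-antisym; ≤-trans; ≤-refl; ≤-reflexive; ⋁-least)
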